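{- $\mathsf{Cheq}$ is a proper sublogic of the Medvedev logic $\mathsf{ML}$, i.e. $\mathsf{Cheq}\subsetneq\mathsf{ML}$. Consequently, $\mathsf{Cheq}$ is also a sublogic of $\mathsf{KS}$, the logic of the weak law of excluded middle, i.e. $\mathsf{Cheq}\subseteq\mathsf{KS}$. Moreover, $\mathsf{Cheq}$ is not structurally complete.
   Context: Let $\mathfrak{F}_1=\langle W_1,R_1\rangle$ be the 2-fork: $W_1=\{w_0,w_-,w_+\}$, and $R_1$ is the partial order in which every point is related to itself and, besides that, exactly $w_0R_1w_-$ and $w_0R_1w_+$ hold. For $n\ge 1$, $\mathfrak{F}_n=\langle W_1^n,R_n\rangle$ is the $n$-fold product of $\mathfrak{F}_1$ with the componentwise (product) order: $\bar xR_n\bar y$ iff $x_iR_1y_i$ for all $i\in\{1,\dots,n\}$. For $n\ge1$, $\mathfrak{M}_n$ is the set of all proper subsets of $\{1,\dots,n+1\}$ (including $\emptyset$), partially ordered by inclusion. Formulas are built from propositional variables with $\wedge,\vee,\rightarrow,\bot$, with $\neg\varphi:=\varphi\rightarrow\bot$, and are interpreted on partially ordered Kripke frames by the standard intuitionistic Kripke semantics (valuations assign upward closed sets to variables). A formula is valid in a frame if it holds at every point under every valuation. $\mathsf{Cheq}$ is the set of all formulas valid in every $\mathfrak{F}_n$, $n\ge1$; $\mathsf{ML}$ is the set of all formulas valid in every $\mathfrak{M}_n$, $n\ge1$. $\mathsf{KS}$ is the least set of formulas that contains intuitionistic propositional logic and the formula $\neg p\vee\neg\neg p$ and is closed under modus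 ponens and uniform substitution. A superintuitionistic logic $L$ is structurally complete if every (finitary, structural) rule $\varphi_1,\dots,\varphi_m/\psi$ admissible in $L$ is derivable in $L$. Here the rule is admissible in $L$ if for every substitution $\sigma$, $\sigma\varphi_1,\dots,\sigma\varphi_m\in L$ implies $\sigma\psi\in L$; it is derivable in $L$ if $\psi$ can be obtained from $\varphi_1,\dots,\varphi_m$ and elements of $L$ by modus ponens, equivalently $(\varphi_1\wedge\dots\wedge\varphi_m)\rightarrow\psi\in L$. -}

module Defs where

open import Data.Bool.Base using (Bool; T)
open import Data.Empty using (⊥)
import Data.Fin.Subset as Subset
open import Data.Fin.Subset.Properties using (⊆-poset)
open import Data.List.Base using (List)
open import Data.List.Membership.Propositional using () renaming (_∈_ to _∈ˡ_)
open import Data.List.Relation.Unary.All using (All)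
open import Data.Nat.Base using (ℕ; suc; _≤_)
open import Data.Product.Base using (_×_; ∃; proj₁)
open import Data.Sum.Base using (_⊎_)
open import Data.Vec.Base using (Vec; []; _∷_)
open import Data.Vec.Relation.Binary.Pointwise.Inductive as Pointwise
  using (Pointwise; []; _∷_)
open import Level using (0ℓ)
open import Relation.Binary.Bundles using (Poset)
import Relation.Binary.Construct.On as On
open import Relation.Binary.PropositionalEquality
  using (_≡_; refl; cong₂; isEquivalence)
open import Relation.Unary using (Pred; _∈_)

infixr 7 _∧_
infixr 6 _∨_
infixr 5 _⇒_
infix  8 ¬ᶠ_

data Formula : Set where
  var : ℕ → Formula
  ⊥ᶠ : Formula
  _∧_ _∨_ _⇒_ : Formula → Formula → Formula

¬ᶠ_ : Formula → Formula
¬ᶠ φ = φ ⇒ ⊥ᶠ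

Substitution : Set
Substitution = ℕ → Formula

infixl 9 _[_]

_[_] : Formula → Substitution → Formula
var p [ σ ] = σ p
⊥ᶠ [ σ ] = ⊥ᶠ
(φ ∧ ψ) [ σ ] = (φ [ σ ]) ∧ (ψ [ σ ])
(φ ∨ ψ) [ σ ] = (φ [ σ ]) ∨ (ψ [ σ ])
(φ ⇒ ψ) [ σ ] = (φ [ σ ]) ⇒ (ψ [ σ ])

Logic : Set₁
Logic = Pred Formula 0ℓ

Frame : Set₁
Frame = Poset 0ℓ 0ℓ 0ℓ

-- A subset of a frame is given by its Boolean characteristic function.  With
-- arbitrary Set-valued predicates, ¬ p ∨ ¬ ¬ p would already be unprovable on
-- a one-point frame; all frames considered below are finite.
record Valuation (F : Frame) : Set where
  private module F = Poset F
  field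
    holds  : ℕ → F.Carrier → Bool
    upward : ∀ p {x y} → x F.≤ y → T (holds p x) → T (holds p y)

module _ (F : Frame) (V : Valuation F) where
  private module F = Poset F
  open Valuation V

  Forces : F.Carrier → Formula → Set
  Forces x (var p) = T (holds p x)
  Forces x ⊥ᶠ      = ⊥
  Forces x (φ ∧ ψ) = Forces x φ × Forces x ψ
  Forces x (φ ∨ ψ) = Forces x φ ⊎ Forces x ψ
  Forces x (φ ⇒ ψ) = ∀ y → x F.≤ y → Forces y φ → Forces y ψ

infix 3 _⊨_

_⊨_ : Frame → Formula → Set
F ⊨ φ = (V : Valuation F) (x : Poset.Carrier F) → Forces F V x φ

data W₁ : Set where
  w₀ w₋ w₊ : W₁

data _R₁_ : W₁ → W₁ → Set where
  here : ∀ {x} → x R₁ x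
  w₀w₋ : w₀ R₁ w₋
  w₀w₊ : w₀ R₁ w₊

R₁-trans : ∀ {x y z} → x R₁ y → y R₁ z → x R₁ z
R₁-trans here q    = q
R₁-trans w₀w₋ here = w₀w₋
R₁-trans w₀w₊ here = w₀w₊

R₁-antisym : ∀ {x y} → x R₁ y → y R₁ x → x ≡ y
R₁-antisym here _ = refl
R₁-antisym w₀w₋ ()
R₁-antisym w₀w₊ ()

_R_ : ∀ {n} → Vec W₁ n → Vec W₁ n → Set
_R_ = Pointwise _R₁_

R-antisym : ∀ {n} {x y : Vec W₁ n} → x R y → y R x → x ≡ y
R-antisym []       []       = refl
R-antisym (p ∷ ps) (q ∷ qs) = cong₂ _∷_ (R₁-antisym p q) (R-antisym ps qs)

𝔉 : ℕ → Frame
𝔉 n = record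
  { Carrier        = Vec W₁ n
  ; _≈_            = _≡_
  ; _≤_            = _R_
  ; isPartialOrder = record
    { isPreorder = record
      { isEquivalence = isEquivalence
      ; reflexive     = λ { refl → Pointwise.refl here }
      ; trans         = Pointwise.trans R₁-trans
      }
    ; antisym    = R-antisym
    }
  }

ProperSubset : ℕ → Set
ProperSubset k = ∃ λ (s : Subset.Subset k) → s Subset.⊂ Subset.⊤

-- Elements are compared through their underlying subsets, so the proof of
-- properness is irrelevant to the equality of the poset.
𝔐 : ℕ → Frame
𝔐 n = On.poset (⊆-poset (suc n)) (proj₁ {B = λ s → s Subset.⊂ Subset.⊤})

Cheq : Logic
Cheq φ = ∀ n → 1 ≤ n → 𝔉 n ⊨ φ

ML : Logic
ML φ = ∀ n → 1 ≤ n → 𝔐 n ⊨ φ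

data IPC : Logic where
  K     : ∀ {φ ψ} → IPC (φ ⇒ ψ ⇒ φ)
  S     : ∀ {φ ψ χ} → IPC ((φ ⇒ ψ ⇒ χ) ⇒ (φ ⇒ ψ) ⇒ φ ⇒ χ)
  pair  : ∀ {φ ψ} → IPC (φ ⇒ ψ ⇒ φ ∧ ψ)
  fst   : ∀ {φ ψ} → IPC (φ ∧ ψ ⇒ φ)
  snd   : ∀ {φ ψ} → IPC (φ ∧ ψ ⇒ ψ)
  inl   : ∀ {φ ψ} → IPC (φ ⇒ φ ∨ ψ)
  inr   : ∀ {φ ψ} → IPC (ψ ⇒ φ ∨ ψ)
  cases : ∀ {φ ψ χ} → IPC ((φ ⇒ χ) ⇒ (ψ ⇒ χ) ⇒ φ ∨ ψ ⇒ χ)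
  efq   : ∀ {φ} → IPC (⊥ᶠ ⇒ φ)
  mp    : ∀ {φ ψ} → IPC (φ ⇒ ψ) → IPC φ → IPC ψ

data KS : Logic where
  ipc : ∀ {φ} → IPC φ → KS φ
  wem : KS (¬ᶠ var 0 ∨ ¬ᶠ ¬ᶠ var 0)
  mp  : ∀ {φ ψ} → KS (φ ⇒ ψ) → KS φ → KS ψ
  sub : ∀ {φ} (σ : Substitution) → KS φ → KS (φ [ σ ])

Admissible : Logic → List Formula → Formula → Set
Admissible L Γ ψ =
  (σ : Substitution) → All (λ φ → φ [ σ ] ∈ L) Γ → ψ [ σ ] ∈ L

data Derivable (L : Logic) (Γ : List Formula) : Formula → Set where
  premise : ∀ {φ} → φ ∈ˡ Γ → Derivable L Γ φ
  theorem : ∀ {φ} → φ ∈ L → Derivable L Γ φ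
  mp      : ∀ {φ ψ} → Derivable L Γ (φ ⇒ ψ) → Derivable L Γ φ → Derivable L Γ ψ

StructurallyComplete : Logic → Set
StructurallyComplete L = ∀ Γ ψ → Admissible L Γ ψ → Derivable L Γ ψ

{-# OPTIONS --safe #-}

-- Cheq ⊆ ML: 𝔐 n is a p-morphic image of 𝔉 n.  The Kreisel–Putnam formula lies in
-- ML, but it fails on the square 𝔉 2.  The corresponding rule is admissible in
-- Cheq, by Prucnal's substitution, and the same square shows that it is not
-- derivable.
--
-- Cheq ⊆ KS: the weak law of excluded middle lets a derivation be split according
-- to which variables are (doubly) negated.  For each such classical assignment, a
-- cut-based search either derives the formula or refutes it on a finite tree with
-- a top added, whose top is labelled by the assignment.  Such a baled tree is a
-- p-morphic image of a cube: each coordinate of the cube, once it leaves w₀,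
-- pushes the state to a fixed node of the tree, and pushes towards incomparable
-- nodes collapse to the top.

module Submission where

open import Defs
open import Data.Product.Base using (_×_)
open import Relation.Nullary using (¬_)
open import Relation.Unary using (_⊂_; _⊆_)

open import Data.Bool.Base using (Bool; true; false; T; if_then_else_)
open import Data.Bool.Properties using (T-≡)
open import Data.Empty using (⊥; ⊥-elim)
open import Data.Fin.Base using (Fin; zero; suc)
open import Data.Fin.Subset as Subset using (Subset; inside; outside; ⁅_⁆; ∁; _∪_)
open import Data.Fin.Subset.Properties
  using (_∈?_; ⊆-antisym; ⊆⊤; ∈⊤; drop-∷-⊆; drop-there; out⊆; s⊆s; x∈⁅x⁆; x≢y⇒x∉⁅y⁆;
         x∈p⇒x∉∁p; x∉p⇒x∈∁p; p⊆p∪q; q⊆p∪q; x∈p∪q⁻)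
open import Data.List.Base using (List; []; _∷_; _++_; length; filter; foldr; concatMap)
import Data.List.Membership.DecPropositional as DecMembership
open import Data.List.Membership.Propositional using (_∉_; lose) renaming (_∈_ to _∈ˡ_)
open import Data.List.Membership.Propositional.Properties
  using (∈-∃++; ∈-filter⁺; ∈-filter⁻; ∈-concatMap⁺; ∈-++⁺ˡ; ∈-++⁺ʳ; ∈-++⁻)
open import Data.List.Relation.Binary.Permutation.Propositional using (_↭_; ↭-sym)
open import Data.List.Relation.Binary.Permutation.Propositional.Properties
  using (shift; ∈-resp-↭; ↭-length)
open import Data.List.Relation.Binary.Subset.Propositional using () renaming (_⊆_ to _⊆ˡ_)
open import Data.List.Relation.Binary.Subset.Propositional.Properties using (∷⁺ʳ)
open import Data.List.Relation.Unary.All as All using (All; []; _∷_)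
open import Data.List.Relation.Unary.Any using (here; there; any?)
open import Data.Nat.Base using (ℕ; zero; suc; _≤_; _<_; _+_; z≤n; s≤s)
import Data.Nat.Properties as ℕ
open import Data.Product.Base as Product using (_,_; ∃-syntax; proj₁; proj₂)
open import Data.Sum.Base as Sum using (_⊎_; inj₁; inj₂; [_,_]′)
open import Data.Unit.Base using (⊤)
open import Data.Vec.Base as Vec
  using (Vec; []; _∷_; tabulate; tail; replicate; take; drop; here; there)
import Data.Vec.Properties as Vec
open import Data.Vec.Relation.Binary.Pointwise.Inductive as Pointwise using ([]; _∷_)
open import Function.Base using (id; _∘_; const)
open import Function.Bundles using (_⇔_; mk⇔; Equivalence)
open import Function.Construct.Composition using (_⇔-∘_)
open import Relation.Binary.Bundles using (Poset)
open import Relation.Binary.PropositionalEquality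
  using (_≡_; _≢_; refl; sym; trans; cong; cong₂; subst)
open import Relation.Nullary using (Dec; yes; no; does; contradiction)
open import Relation.Nullary.Decidable
  using (toWitness; fromWitness; isYes; ¬?; _×-dec_; _⊎-dec_; _→-dec_; T?; map′;
         decidable-stable; dec-true; dec-false)
open import Relation.Unary using (_∈_)

open Equivalence using (to; from)

-- Kripke frames, bisimulations and p-morphisms

Point : Frame → Set
Point = Poset.Carrier

Order Equality : (F : Frame) → Point F → Point F → Set
Order    = Poset._≤_
Equality = Poset._≈_

infix 4 Order Equality
syntax Order F x y    = x ≤[ F ] y
syntax Equality F x y = x ≈[ F ] y

module _ {F : Frame} {V : Valuation F} where

  persist : ∀ {x y} φ → x ≤[ F ] y → Forces F V x φ → Forces F V y φ
  persist (var p) x≤y f        = Valuation.upward V p x≤y f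
  persist (φ ∧ ψ) x≤y (f , g)  = persist φ x≤y f , persist ψ x≤y g
  persist (φ ∨ ψ) x≤y (inj₁ f) = inj₁ (persist φ x≤y f)
  persist (φ ∨ ψ) x≤y (inj₂ f) = inj₂ (persist ψ x≤y f)
  persist (φ ⇒ ψ) x≤y f z y≤z  = f z (Poset.trans F x≤y y≤z)

module _ (F : Frame) {P : ℕ → Point F → Set} (P? : ∀ p x → Dec (P p x))
         (P-upward : ∀ p {x y} → x ≤[ F ] y → P p x → P p y) where

  decValuation : Valuation F
  decValuation = record
    { holds  = λ p x → isYes (P? p x)
    ; upward = λ p {x} {y} x≤y h →
        fromWitness {a? = P? p y} (P-upward p x≤y (toWitness {a? = P? p x} h))
    }

  decValuation-⇔ : ∀ p x → T (Valuation.holds decValuation p x) ⇔ P p x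
  decValuation-⇔ p x = mk⇔ (toWitness {a? = P? p x}) (fromWitness {a? = P? p x})

-- A relation rather than a map: besides graphs of p-morphisms, Prucnal's argument needs two
-- relations that cover only some of the points.
record Bisimulation {F G : Frame} (V : Valuation F) (U : Valuation G) : Set₁ where
  field
    _∼_   : Point F → Point G → Set
    atoms : ∀ {x y} → x ∼ y → ∀ p → T (Valuation.holds V p x) ⇔ T (Valuation.holds U p y)
    forth : ∀ {x y x′} → x ∼ y → x ≤[ F ] x′ → ∃[ y′ ] y ≤[ G ] y′ × x′ ∼ y′
    back  : ∀ {x y y′} → x ∼ y → y ≤[ G ] y′ → ∃[ x′ ] x ≤[ F ] x′ × x′ ∼ y′

  forces-⇔ : ∀ φ {x y} → x ∼ y → Forces F V x φ ⇔ Forces G U y φ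
  forces-⇔ (var p) x∼y = atoms x∼y p
  forces-⇔ ⊥ᶠ      x∼y = mk⇔ id id
  forces-⇔ (φ ∧ ψ) x∼y = mk⇔
    (Product.map (to (forces-⇔ φ x∼y)) (to (forces-⇔ ψ x∼y)))
    (Product.map (from (forces-⇔ φ x∼y)) (from (forces-⇔ ψ x∼y)))
  forces-⇔ (φ ∨ ψ) x∼y = mk⇔
    (Sum.map (to (forces-⇔ φ x∼y)) (to (forces-⇔ ψ x∼y)))
    (Sum.map (from (forces-⇔ φ x∼y)) (from (forces-⇔ ψ x∼y)))
  forces-⇔ (φ ⇒ ψ) x∼y = mk⇔
    (λ f y′ y≤y′ g → let x′ , x≤x′ , x′∼y′ = back x∼y y≤y′ in
      to (forces-⇔ ψ x′∼y′) (f x′ x≤x′ (from (forces-⇔ φ x′∼y′) g)))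
    (λ f x′ x≤x′ g → let y′ , y≤y′ , x′∼y′ = forth x∼y x≤x′ in
      from (forces-⇔ ψ x′∼y′) (f y′ y≤y′ (to (forces-⇔ φ x′∼y′) g)))

record PMorphism (F G : Frame) : Set where
  field
    fun        : Point F → Point G
    mono       : ∀ {x y} → x ≤[ F ] y → fun x ≤[ G ] fun y
    back       : ∀ {x z} → fun x ≤[ G ] z → ∃[ y ] x ≤[ F ] y × fun y ≈[ G ] z
    surjective : ∀ z → ∃[ x ] fun x ≈[ G ] z

  pullback : Valuation G → Valuation F
  pullback U = record
    { holds  = λ p x → Valuation.holds U p (fun x)
    ; upward = λ p x≤y → Valuation.upward U p (mono x≤y)
    }

  graph : (U : Valuation G) → Bisimulation (pullback U) U
  graph U = record
    { _∼_   = λ x y → fun x ≈[ G ] y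
    ; atoms = λ fx≈y p → mk⇔ (Valuation.upward U p (≤ᴳ fx≈y)) (Valuation.upward U p (≥ᴳ fx≈y))
    ; forth = λ {_} {_} {x′} fx≈y x≤x′ →
        fun x′ , Poset.trans G (≥ᴳ fx≈y) (mono x≤x′) , Poset.Eq.refl G
    ; back  = λ fx≈y y≤y′ → back (Poset.trans G (≤ᴳ fx≈y) y≤y′)
    }
    where
    ≤ᴳ : ∀ {x y} → x ≈[ G ] y → x ≤[ G ] y
    ≤ᴳ = Poset.reflexive G
    ≥ᴳ : ∀ {x y} → x ≈[ G ] y → y ≤[ G ] x
    ≥ᴳ = Poset.reflexive G ∘ Poset.Eq.sym G

  validity : ∀ φ → F ⊨ φ → G ⊨ φ
  validity φ F⊨φ U z = let x , fx≈z = surjective z in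
    to (Bisimulation.forces-⇔ (graph U) φ fx≈z) (F⊨φ (pullback U) x)

-- Cheq and the Medvedev logic

Proper : ∀ {n} → Subset n → Set
Proper s = ∃[ i ] i Subset.∉ s

proper⊂⊤ : ∀ {n} {s : Subset n} → Proper s → s Subset.⊂ Subset.⊤
proper⊂⊤ (i , i∉s) = ⊆⊤ , i , ∈⊤ , i∉s

⊂⊤⇒proper : ∀ {n} {s : Subset n} → s Subset.⊂ Subset.⊤ → Proper s
⊂⊤⇒proper (_ , i , _ , i∉s) = i , i∉s

full⊎proper : ∀ {n} (s : Subset n) → s ≡ Subset.⊤ ⊎ Proper s
full⊎proper []            = inj₁ refl
full⊎proper (outside ∷ s) = inj₂ (zero , λ ())
full⊎proper (inside ∷ s)  =
  Sum.map (cong (inside ∷_)) (λ (i , i∉s) → suc i , i∉s ∘ drop-there) (full⊎proper s)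

-- Colour a vertex of the cube by the first coordinate carrying w₊, with an
-- extra last colour when there is none; a face is sent to the set of the
-- colours missing from its vertices.
missing : ∀ {n} → Vec W₁ n → Subset (suc n)
missing []       = outside ∷ []
missing (w₊ ∷ x) = outside ∷ Subset.⊤
missing (w₋ ∷ x) = inside ∷ missing x
missing (w₀ ∷ x) = outside ∷ missing x

-- A face has some vertex, and the colour of that vertex is not missing.
missing-proper : ∀ {n} (x : Vec W₁ n) → Proper (missing x)
missing-proper []       = zero , λ ()
missing-proper (w₊ ∷ x) = zero , λ ()
missing-proper (w₀ ∷ x) = zero , λ ()
missing-proper (w₋ ∷ x) = let i , i∉ = missing-proper x in suc i , i∉ ∘ drop-there

missing-mono : ∀ {n} {x y : Vec W₁ n} → x R y → missing x Subset.⊆ missing y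
missing-mono []                  = id
missing-mono {x = w₊ ∷ _} (here ∷ _) = id
missing-mono {x = w₋ ∷ _} (here ∷ r) = s⊆s (missing-mono r)
missing-mono {x = w₀ ∷ _} (here ∷ r) = s⊆s (missing-mono r)
missing-mono (w₀w₋ ∷ r)          = out⊆ (missing-mono r)
missing-mono (w₀w₊ ∷ r)          = out⊆ ⊆⊤

-- `y` is read off from `s`: a free coordinate becomes `w₋` if its colour must go, `w₊` if its
-- colour stays and all later ones go, and remains `w₀` otherwise.
missing-back : ∀ {n} (x : Vec W₁ n) {s} → missing x Subset.⊆ s → Proper s →
               ∃[ y ] x R y × missing y ≡ s
missing-back []       {outside ∷ []} _ _ = [] , [] , refl
missing-back []       {inside ∷ []}  _ (zero , 0∉s) = contradiction here 0∉s
missing-back (w₊ ∷ x) {outside ∷ s} inc _ =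
  w₊ ∷ x , Pointwise.refl here , cong (outside ∷_) (⊆-antisym (drop-∷-⊆ inc) ⊆⊤)
missing-back (w₊ ∷ x) {inside ∷ s} inc (zero  , 0∉s) = contradiction here 0∉s
missing-back (w₊ ∷ x) {inside ∷ s} inc (suc i , i∉s) = contradiction (inc (there ∈⊤)) i∉s
missing-back (w₋ ∷ x) {outside ∷ s} inc _ = contradiction (inc here) λ ()
missing-back (w₋ ∷ x) {inside ∷ s} inc (zero , 0∉s) = contradiction here 0∉s
missing-back (w₋ ∷ x) {inside ∷ s} inc (suc i , i∉s) =
  let y , r , eq = missing-back x (drop-∷-⊆ inc) (i , i∉s ∘ there)
  in w₋ ∷ y , here ∷ r , cong (inside ∷_) eq
missing-back (w₀ ∷ x) {inside ∷ s} inc (zero , 0∉s) = contradiction here 0∉s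
missing-back (w₀ ∷ x) {inside ∷ s} inc (suc i , i∉s) =
  let y , r , eq = missing-back x (drop-∷-⊆ inc) (i , i∉s ∘ there)
  in w₋ ∷ y , w₀w₋ ∷ r , cong (inside ∷_) eq
missing-back (w₀ ∷ x) {outside ∷ s} inc _ with full⊎proper s
... | inj₁ refl = w₊ ∷ x , w₀w₊ ∷ Pointwise.refl here , refl
... | inj₂ s-proper =
  let y , r , eq = missing-back x (drop-∷-⊆ inc) s-proper
  in w₀ ∷ y , here ∷ r , cong (outside ∷_) eq

cube→medvedev : ∀ n → PMorphism (𝔉 n) (𝔐 n)
cube→medvedev n = record
  { fun        = λ x → missing x , proper⊂⊤ (missing-proper x)
  ; mono       = missing-mono
  ; back       = λ {x} {z} inc → missing-back x inc (⊂⊤⇒proper (proj₂ z))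
  -- No colour is missing from the whole cube, so every proper subset is reached from the root.
  ; surjective = λ z →
      let y , _ , eq = missing-back (replicate n w₀) (λ i∈ → ⊥-elim (∉missing-root n i∈))
                                    (⊂⊤⇒proper (proj₂ z))
      in y , eq
  }
  where
  ∉missing-root : ∀ n {i} → i Subset.∉ missing (replicate n w₀)
  ∉missing-root zero    (there ())
  ∉missing-root (suc n) (there i∈) = ∉missing-root n i∈

Cheq⊆ML : Cheq ⊆ ML
Cheq⊆ML {φ} φ∈Cheq n 1≤n = PMorphism.validity (cube→medvedev n) φ (φ∈Cheq n 1≤n)

-- The Kreisel-Putnam formula on `𝔐 n` and on the square

harropPremise harropConclusion kreiselPutnam : Formula
harropPremise    = ¬ᶠ var 0 ⇒ var 1 ∨ var 2
harropConclusion = (¬ᶠ var 0 ⇒ var 1) ∨ (¬ᶠ var 0 ⇒ var 2)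
kreiselPutnam    = harropPremise ⇒ harropConclusion

-- The points above s forcing ¬ p are exactly those containing meet.  Hence, if
-- meet is itself a point, it forces ¬ p, and it decides the disjunction.
kreiselPutnam∈ML : ML kreiselPutnam
kreiselPutnam∈ML n _ V _ (s , s⊂⊤) _ prem =
  [ if-full , if-proper ]′ (full⊎proper meet)
  where
  open Valuation V
  F = 𝔐 n

  coatom : Fin (suc n) → ProperSubset (suc n)
  coatom i = ∁ ⁅ i ⁆ , proper⊂⊤ (i , x∈p⇒x∉∁p (x∈⁅x⁆ i))

  ⊆coatom : ∀ {i} {t : Subset (suc n)} → i Subset.∉ t → t Subset.⊆ ∁ ⁅ i ⁆
  ⊆coatom i∉t j∈t = x∉p⇒x∈∁p (x≢y⇒x∉⁅y⁆ λ { refl → i∉t j∈t })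

  p-coatom : Fin (suc n) → Bool
  p-coatom i = holds 0 (coatom i)

  -- A point omitting `i` lies below `coatom i`; so a point forcing `¬ p` contains every `i` whose
  -- coatom forces `p`.
  p-coatoms : Subset (suc n)
  p-coatoms = tabulate p-coatom

  p-coatom⁺ : ∀ {i} → T (holds 0 (coatom i)) → i Subset.∈ p-coatoms
  p-coatom⁺ {i} h = Vec.lookup⇒[]= i p-coatoms (trans (Vec.lookup∘tabulate p-coatom i) (to T-≡ h))

  p-coatom⁻ : ∀ {i} → i Subset.∈ p-coatoms → T (holds 0 (coatom i))
  p-coatom⁻ {i} i∈ = from T-≡ (trans (sym (Vec.lookup∘tabulate p-coatom i)) (Vec.[]=⇒lookup i∈))

  meet : Subset (suc n)
  meet = s ∪ p-coatoms

  meet⊆ : ∀ ((t , t⊂⊤) : ProperSubset (suc n)) → s Subset.⊆ t →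
          Forces F V (t , t⊂⊤) (¬ᶠ var 0) → meet Subset.⊆ t
  meet⊆ (t , _) s⊆t ¬p {i} i∈ with x∈p∪q⁻ s p-coatoms i∈ | i ∈? t
  ... | _        | yes i∈t = i∈t
  ... | inj₁ i∈s | no _    = s⊆t i∈s
  ... | inj₂ i∈q | no i∉t  = ⊥-elim (¬p (coatom i) (⊆coatom i∉t) (p-coatom⁻ i∈q))

  -- No point above `s` forces `¬ p` here, so the first disjunct holds vacuously.
  if-full : meet ≡ Subset.⊤ → Forces F V (s , s⊂⊤) harropConclusion
  if-full eq = inj₁ λ (t , t⊂⊤) s⊆t ¬p → let i , i∉t = ⊂⊤⇒proper t⊂⊤ in
    contradiction (meet⊆ (t , t⊂⊤) s⊆t ¬p (subst (i Subset.∈_) (sym eq) ∈⊤)) i∉t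

  if-proper : Proper meet → Forces F V (s , s⊂⊤) harropConclusion
  if-proper meet-proper = Sum.map (spread 1) (spread 2) (prem m (p⊆p∪q p-coatoms) meet-¬p)
    where
    m : ProperSubset (suc n)
    m = meet , proper⊂⊤ meet-proper

    -- If `t` above `meet` forced `p` and omitted `i`, then `coatom i` would force `p`, which puts
    -- `i` into `meet` and thus into `t`.
    meet-¬p : Forces F V m (¬ᶠ var 0)
    meet-¬p (t , t⊂⊤) meet⊆t pt = let i , i∉t = ⊂⊤⇒proper t⊂⊤ in
      i∉t (meet⊆t (q⊆p∪q s p-coatoms
        (p-coatom⁺ (upward 0 {t , t⊂⊤} {coatom i} (⊆coatom i∉t) pt))))

    spread : ∀ q → Forces F V m (var q) → Forces F V (s , s⊂⊤) (¬ᶠ var 0 ⇒ var q)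
    spread q qm t s⊆t ¬p = upward q {m} {t} (meet⊆ t s⊆t ¬p) qm

_≟ʷ_ : (a b : W₁) → Dec (a ≡ b)
w₀ ≟ʷ w₀ = yes refl
w₋ ≟ʷ w₋ = yes refl
w₊ ≟ʷ w₊ = yes refl
w₀ ≟ʷ w₋ = no λ ()
w₀ ≟ʷ w₊ = no λ ()
w₋ ≟ʷ w₀ = no λ ()
w₋ ≟ʷ w₊ = no λ ()
w₊ ≟ʷ w₀ = no λ ()
w₊ ≟ʷ w₋ = no λ ()

_≟ᵛ_ : ∀ {n} (x y : Vec W₁ n) → Dec (x ≡ y)
_≟ᵛ_ = Vec.≡-dec _≟ʷ_

-- p holds at two opposite corners of the square, q and r at one each of the
-- remaining two.
corners : ℕ → List (Vec W₁ 2)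
corners 0 = (w₊ ∷ w₊ ∷ []) ∷ (w₋ ∷ w₋ ∷ []) ∷ []
corners 1 = (w₊ ∷ w₋ ∷ []) ∷ []
corners 2 = (w₋ ∷ w₊ ∷ []) ∷ []
corners _ = []

corners-upward : ∀ p {x y} → x R y → x ∈ˡ corners p → y ∈ˡ corners p
corners-upward 0 (here ∷ here ∷ []) (here refl)         = here refl
corners-upward 0 (here ∷ here ∷ []) (there (here refl)) = there (here refl)
corners-upward 1 (here ∷ here ∷ []) (here refl)         = here refl
corners-upward 2 (here ∷ here ∷ []) (here refl)         = here refl
corners-upward (suc (suc (suc _))) _ ()

cornerValuation : Valuation (𝔉 2)
cornerValuation = decValuation (𝔉 2) (λ p x → x ∈ˡ? corners p) corners-upward
  where open DecMembership _≟ᵛ_ renaming (_∈?_ to _∈ˡ?_)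

-- Apart from the two corners carrying q and r, every point of the square sees a corner carrying p.
corner-premise : Forces (𝔉 2) cornerValuation (w₀ ∷ w₀ ∷ []) harropPremise
corner-premise (w₊ ∷ w₋ ∷ []) _ _  = inj₁ _
corner-premise (w₋ ∷ w₊ ∷ []) _ _  = inj₂ _
corner-premise (w₊ ∷ w₊ ∷ []) _ ¬p = ⊥-elim (¬p _ (here ∷ here ∷ []) _)
corner-premise (w₊ ∷ w₀ ∷ []) _ ¬p = ⊥-elim (¬p (w₊ ∷ w₊ ∷ []) (here ∷ w₀w₊ ∷ []) _)
corner-premise (w₋ ∷ w₋ ∷ []) _ ¬p = ⊥-elim (¬p _ (here ∷ here ∷ []) _)
corner-premise (w₋ ∷ w₀ ∷ []) _ ¬p = ⊥-elim (¬p (w₋ ∷ w₋ ∷ []) (here ∷ w₀w₋ ∷ []) _)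
corner-premise (w₀ ∷ w₊ ∷ []) _ ¬p = ⊥-elim (¬p (w₊ ∷ w₊ ∷ []) (w₀w₊ ∷ here ∷ []) _)
corner-premise (w₀ ∷ w₋ ∷ []) _ ¬p = ⊥-elim (¬p (w₋ ∷ w₋ ∷ []) (w₀w₋ ∷ here ∷ []) _)
corner-premise (w₀ ∷ w₀ ∷ []) _ ¬p = ⊥-elim (¬p (w₊ ∷ w₊ ∷ []) (w₀w₊ ∷ w₀w₊ ∷ []) _)

-- The corners carrying q and r both force `¬ p`, but the one for r lacks q and the one for q lacks
-- r.
¬corner-conclusion : ¬ Forces (𝔉 2) cornerValuation (w₀ ∷ w₀ ∷ []) harropConclusion
¬corner-conclusion (inj₁ f) =
  f (w₋ ∷ w₊ ∷ []) (w₀w₋ ∷ w₀w₊ ∷ []) λ { _ (here ∷ here ∷ []) () }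
¬corner-conclusion (inj₂ f) =
  f (w₊ ∷ w₋ ∷ []) (w₀w₊ ∷ w₀w₋ ∷ []) λ { _ (here ∷ here ∷ []) () }

1≤2 : 1 ≤ 2
1≤2 = s≤s z≤n

ML⊈Cheq : ¬ (ML ⊆ Cheq)
ML⊈Cheq ML⊆Cheq = ¬corner-conclusion
  (ML⊆Cheq {kreiselPutnam} kreiselPutnam∈ML 2 1≤2 cornerValuation _ _
    (Poset.refl (𝔉 2)) corner-premise)

-- Modus ponens is the only rule of inference, so truth at one fixed point under one fixed valuation
-- is preserved.
Cheq-derivable-sound : ∀ {n} {V : Valuation (𝔉 n)} {x Γ} → 1 ≤ n →
                       All (Forces (𝔉 n) V x) Γ →
                       ∀ {φ} → Derivable Cheq Γ φ → Forces (𝔉 n) V x φ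
Cheq-derivable-sound _   Γ-forced (premise φ∈Γ)    = All.lookup Γ-forced φ∈Γ
Cheq-derivable-sound {n} {V} {x} 1≤n _ (theorem φ∈Cheq) = φ∈Cheq n 1≤n V x
Cheq-derivable-sound {n} 1≤n Γ-forced (mp d e) =
  Cheq-derivable-sound 1≤n Γ-forced d _ (Poset.refl (𝔉 n)) (Cheq-derivable-sound 1≤n Γ-forced e)

harrop-not-derivable : ¬ Derivable Cheq (harropPremise ∷ []) harropConclusion
harrop-not-derivable = λ d →
  ¬corner-conclusion (Cheq-derivable-sound {V = cornerValuation} 1≤2 (corner-premise ∷ []) d)

-- Admissibility of the Harrop rule

-- Constructive search through a finite cone, branching only at coordinates `w₀`. It makes forcing
-- on cubes decidable, so that formulas define Boolean valuations.
searchAbove : ∀ {n} {P : Vec W₁ n → Set} → (∀ y → Dec (P y)) →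
              ∀ x → (∃[ y ] x R y × P y) ⊎ (∀ y → x R y → ¬ P y)
searchAbove P? [] with P? []
... | yes p = inj₁ ([] , [] , p)
... | no ¬p = inj₂ λ { [] [] → ¬p }
searchAbove P? (w₊ ∷ x) = Sum.map
  (λ (y , r , p) → w₊ ∷ y , here ∷ r , p)
  (λ { none (_ ∷ y) (here ∷ r) → none y r })
  (searchAbove (P? ∘ (w₊ ∷_)) x)
searchAbove P? (w₋ ∷ x) = Sum.map
  (λ (y , r , p) → w₋ ∷ y , here ∷ r , p)
  (λ { none (_ ∷ y) (here ∷ r) → none y r })
  (searchAbove (P? ∘ (w₋ ∷_)) x)
searchAbove P? (w₀ ∷ x)
  with searchAbove (P? ∘ (w₊ ∷_)) x | searchAbove (P? ∘ (w₋ ∷_)) x | searchAbove (P? ∘ (w₀ ∷_)) x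
... | inj₁ (y , r , p) | _ | _ = inj₁ (w₊ ∷ y , w₀w₊ ∷ r , p)
... | inj₂ _ | inj₁ (y , r , p) | _ = inj₁ (w₋ ∷ y , w₀w₋ ∷ r , p)
... | inj₂ _ | inj₂ _ | inj₁ (y , r , p) = inj₁ (w₀ ∷ y , here ∷ r , p)
... | inj₂ none₊ | inj₂ none₋ | inj₂ none₀ = inj₂ λ
  { (_ ∷ y) (w₀w₊ ∷ r) → none₊ y r
  ; (_ ∷ y) (w₀w₋ ∷ r) → none₋ y r
  ; (_ ∷ y) (here ∷ r) → none₀ y r
  }

allAbove? : ∀ {n} {P : Vec W₁ n → Set} → (∀ y → Dec (P y)) →
            ∀ x → Dec (∀ y → x R y → P y)
allAbove? P? x with searchAbove (¬? ∘ P?) x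
... | inj₁ (y , r , ¬p) = no λ all → ¬p (all y r)
... | inj₂ none         = yes λ y r → decidable-stable (P? y) (none y r)

module _ {n} (V : Valuation (𝔉 n)) where

  forces? : ∀ φ x → Dec (Forces (𝔉 n) V x φ)
  forces? (var p) x = T? (Valuation.holds V p x)
  forces? ⊥ᶠ      x = no id
  forces? (φ ∧ ψ) x = forces? φ x ×-dec forces? ψ x
  forces? (φ ∨ ψ) x = forces? φ x ⊎-dec forces? ψ x
  forces? (φ ⇒ ψ) x = map′ (λ f y r → f y r) (λ f y r → f y r)
    (allAbove? (λ y → forces? φ y →-dec forces? ψ y) x)

Vertex : ∀ {n} → Vec W₁ n → Set
Vertex x = ∀ {y} → x R y → x ≡ y

vertexAbove : ∀ {n} (x : Vec W₁ n) → ∃[ e ] x R e × Vertex e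
vertexAbove []       = [] , [] , λ { [] → refl }
vertexAbove (w₀ ∷ x) = let e , r , v = vertexAbove x in
  w₊ ∷ e , w₀w₊ ∷ r , λ { (here ∷ s) → cong (w₊ ∷_) (v s) }
vertexAbove (w₊ ∷ x) = let e , r , v = vertexAbove x in
  w₊ ∷ e , here ∷ r , λ { (here ∷ s) → cong (w₊ ∷_) (v s) }
vertexAbove (w₋ ∷ x) = let e , r , v = vertexAbove x in
  w₋ ∷ e , here ∷ r , λ { (here ∷ s) → cong (w₋ ∷_) (v s) }

-- Prucnal's substitution: each variable p becomes ¬ φ ⇒ p or ¬ φ ∧ p, according
-- to its value at a vertex e forcing ¬ φ.  It changes nothing at the points
-- forcing ¬ φ, and makes every other vertex a copy of e.
module Prucnal {n} (V : Valuation (𝔉 n)) (φ : Formula)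
               {e} (e-vertex : Vertex e) (e-¬φ : Forces (𝔉 n) V e (¬ᶠ φ)) where
  private F = 𝔉 n

  τ : Substitution
  τ p = if Valuation.holds V p e then ¬ᶠ φ ⇒ var p else ¬ᶠ φ ∧ var p

  shifted : Valuation F
  shifted = decValuation F (λ p → forces? V (τ p)) (λ p → persist (τ p))

  shifted-⇔ : ∀ p x → T (Valuation.holds shifted p x) ⇔ Forces F V x (τ p)
  shifted-⇔ = decValuation-⇔ F (λ p → forces? V (τ p)) (λ p → persist (τ p))

  τ-at-¬φ : ∀ {x} p → Forces F V x (¬ᶠ φ) →
                Forces F V x (τ p) ⇔ T (Valuation.holds V p x)
  τ-at-¬φ p ¬φ with Valuation.holds V p e
  ... | true  = mk⇔ (λ f → f _ (Poset.refl F) ¬φ) (λ h y x≤y _ → Valuation.upward V p x≤y h)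
  ... | false = mk⇔ proj₂ (λ h → ¬φ , h)

  τ-off-¬φ : ∀ {z} p → Vertex z → ¬ Forces F V z (¬ᶠ φ) →
                 Forces F V z (τ p) ⇔ T (Valuation.holds V p e)
  τ-off-¬φ p z-vertex z-φ with Valuation.holds V p e
  ... | true  = mk⇔ _ λ _ y z≤y ¬φ →
    ⊥-elim (z-φ (subst (λ w → Forces F V w (¬ᶠ φ)) (sym (z-vertex z≤y)) ¬φ))
  ... | false = mk⇔ (λ (¬φ , _) → z-φ ¬φ) λ ()

  at-¬φ : Bisimulation shifted V
  at-¬φ = record
    { _∼_   = λ x y → x ≡ y × Forces F V x (¬ᶠ φ)
    ; atoms = λ { {x} (refl , ¬φ) p → τ-at-¬φ p ¬φ ⇔-∘ shifted-⇔ p x }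
    ; forth = λ { (refl , ¬φ) x≤y → _ , x≤y , refl , persist (¬ᶠ φ) x≤y ¬φ }
    ; back  = λ { (refl , ¬φ) x≤y → _ , x≤y , refl , persist (¬ᶠ φ) x≤y ¬φ }
    }

  off-¬φ : Bisimulation shifted V
  off-¬φ = record
    { _∼_   = λ z y → (Vertex z × ¬ Forces F V z (¬ᶠ φ)) × y ≡ e
    ; atoms = λ { {z} ((z-vertex , z-φ) , refl) p → τ-off-¬φ p z-vertex z-φ ⇔-∘ shifted-⇔ p z }
    ; forth = λ { ((z-vertex , z-φ) , refl) z≤x → _ , Poset.refl F , off z-vertex z-φ z≤x , refl }
    ; back  = λ { (off-z , refl) e≤y → _ , Poset.refl F , off-z , sym (e-vertex e≤y) }
    }
    where
    off : ∀ {z x} → Vertex z → ¬ Forces F V z (¬ᶠ φ) → z R x → Vertex x × ¬ Forces F V x (¬ᶠ φ)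
    off z-vertex z-φ z≤x with z-vertex z≤x
    ... | refl = z-vertex , z-φ

  shifted-agrees : ∀ χ {x} → Forces F V x (¬ᶠ φ) → Forces F shifted x χ ⇔ Forces F V x χ
  shifted-agrees χ ¬φ = Bisimulation.forces-⇔ at-¬φ χ (refl , ¬φ)

  -- If `φ` held at `y`, it would persist to a vertex `z`. There the shifted valuation looks like
  -- `V` at a point forcing `¬ φ`: at `z` itself or at `e`.
  shifted-¬φ : ∀ x → Forces F shifted x (¬ᶠ φ)
  shifted-¬φ x y _ yφ with vertexAbove y
  ... | z , y≤z , z-vertex with forces? V (¬ᶠ φ) z
  ...   | yes ¬φ = ¬φ z (Poset.refl F) (to (shifted-agrees φ ¬φ) (persist φ y≤z yφ))
  ...   | no z-φ = e-¬φ e (Poset.refl F)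
    (to (Bisimulation.forces-⇔ off-¬φ φ ((z-vertex , z-φ) , refl)) (persist φ y≤z yφ))

-- The premise is applied to the shifted valuation, where the negation of `σ 0` holds everywhere, so
-- one disjunct holds at `x`. It persists upwards, and wherever `V` forces that negation the two
-- valuations agree.
harrop-admissible : Admissible Cheq (harropPremise ∷ []) harropConclusion
harrop-admissible σ (prem ∷ []) n 1≤n V x with searchAbove (forces? V (¬ᶠ (σ 0))) x
... | inj₂ none = inj₁ λ y x≤y ¬φ → ⊥-elim (none y x≤y ¬φ)
... | inj₁ (y , x≤y , ¬φ) with vertexAbove y
...   | e , y≤e , e-vertex = Sum.map (transfer (σ 1)) (transfer (σ 2))
        (prem n 1≤n shifted x x (Poset.refl (𝔉 n)) (shifted-¬φ x))
  where
  open Prucnal V (σ 0) e-vertex (persist (¬ᶠ (σ 0)) y≤e ¬φ)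

  transfer : ∀ χ → Forces (𝔉 n) shifted x χ → Forces (𝔉 n) V x (¬ᶠ (σ 0) ⇒ χ)
  transfer χ xχ z x≤z ¬φ = to (shifted-agrees χ ¬φ) (persist χ x≤z xχ)

Cheq-not-structurally-complete : ¬ StructurallyComplete Cheq
Cheq-not-structurally-complete complete =
  harrop-not-derivable (complete _ _ harrop-admissible)

-- Cheq and the weak law of excluded middle

module _ {L : Logic} where

  weaken : ∀ {Γ Γ′ φ} → Γ ⊆ˡ Γ′ → Derivable L Γ φ → Derivable L Γ′ φ
  weaken Γ⊆Γ′ (premise φ∈Γ) = premise (Γ⊆Γ′ φ∈Γ)
  weaken Γ⊆Γ′ (theorem φ∈L) = theorem φ∈L
  weaken Γ⊆Γ′ (mp d e)      = mp (weaken Γ⊆Γ′ d) (weaken Γ⊆Γ′ e)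

  -- Hypotheses that stay fixed can be counted among the theorems of the logic; here they are turned
  -- back into hypotheses.
  relativise : ∀ {H φ} → Derivable (Derivable L H) [] φ → Derivable L H φ
  relativise (theorem d) = d
  relativise (mp d e)    = mp (relativise d) (relativise e)

module NaturalDeduction {L : Logic} (ipc⊆L : IPC ⊆ L) where

  infix 3 _⊢_
  _⊢_ : List Formula → Formula → Set
  Γ ⊢ φ = Derivable L Γ φ

  private variable
    Γ Δ : List Formula
    φ ψ χ : Formula

  axiom : IPC φ → Γ ⊢ φ
  axiom d = theorem (ipc⊆L d)

  -- The deduction theorem by bracket abstraction; the discharged hypothesis itself becomes the
  -- identity `S K K`.
  ⇒-intro : φ ∷ Γ ⊢ ψ → Γ ⊢ φ ⇒ ψ
  ⇒-intro {φ} (premise (here refl)) = mp (mp (axiom S) (axiom K)) (axiom (K {ψ = φ}))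
  ⇒-intro (premise (there ψ∈Γ))     = mp (axiom K) (premise ψ∈Γ)
  ⇒-intro (theorem ψ∈L)             = mp (axiom K) (theorem ψ∈L)
  ⇒-intro (mp d e)                  = mp (mp (axiom S) (⇒-intro d)) (⇒-intro e)

  ∨-elim : Γ ⊢ φ ∨ ψ → φ ∷ Γ ⊢ χ → ψ ∷ Γ ⊢ χ → Γ ⊢ χ
  ∨-elim d e f = mp (mp (mp (axiom cases) (⇒-intro e)) (⇒-intro f)) d

  ∨-introˡ : Γ ⊢ φ → Γ ⊢ φ ∨ ψ
  ∨-introˡ = mp (axiom inl)

  ∨-introʳ : Γ ⊢ ψ → Γ ⊢ φ ∨ ψ
  ∨-introʳ = mp (axiom inr)

  ∧-intro : Γ ⊢ φ → Γ ⊢ ψ → Γ ⊢ φ ∧ ψ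
  ∧-intro d e = mp (mp (axiom pair) d) e

  ∧-elimˡ : Γ ⊢ φ ∧ ψ → Γ ⊢ φ
  ∧-elimˡ = mp (axiom fst)

  ∧-elimʳ : Γ ⊢ φ ∧ ψ → Γ ⊢ ψ
  ∧-elimʳ = mp (axiom snd)

  ⊥-elimᶠ : Γ ⊢ ⊥ᶠ → Γ ⊢ φ
  ⊥-elimᶠ = mp (axiom efq)

  hyp₀ : φ ∷ Γ ⊢ φ
  hyp₀ = premise (here refl)

  hyp₁ : φ ∷ ψ ∷ Γ ⊢ ψ
  hyp₁ = premise (there (here refl))

  weaken₁ : Γ ⊢ φ → ψ ∷ Γ ⊢ φ
  weaken₁ = weaken there

  ⋁ : List Formula → Formula
  ⋁ = foldr _∨_ ⊥ᶠ

  ⋁-intro : φ ∈ˡ Δ → Γ ⊢ φ → Γ ⊢ ⋁ Δ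
  ⋁-intro (here refl) d = ∨-introˡ d
  ⋁-intro (there φ∈Δ) d = ∨-introʳ (⋁-intro φ∈Δ d)

-- Labelled cubes and the truth lemma

record Label : Set where
  constructor label
  field pos neg : List Formula

open Label

-- The local part of forcing a formula of `pos L`. For an implication the condition recurs at every
-- point above, because `pos` grows.
Supported : Label → Formula → Set
Supported L (var p) = ⊤
Supported L ⊥ᶠ      = ⊥
Supported L (φ ∧ ψ) = φ ∈ˡ pos L × ψ ∈ˡ pos L
Supported L (φ ∨ ψ) = φ ∈ˡ pos L ⊎ ψ ∈ˡ pos L
Supported L (φ ⇒ ψ) = φ ∈ˡ neg L ⊎ ψ ∈ˡ pos L

-- Failure at this very point. A formula in `neg` need only be refuted somewhere above; as forcing
-- persists, it then fails below as well.
Refuted : Label → Formula → Set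
Refuted L (var p) = var p ∉ pos L
Refuted L ⊥ᶠ      = ⊤
Refuted L (φ ∧ ψ) = φ ∈ˡ neg L ⊎ ψ ∈ˡ neg L
Refuted L (φ ∨ ψ) = φ ∈ˡ neg L × ψ ∈ˡ neg L
Refuted L (φ ⇒ ψ) = φ ∈ˡ pos L × ψ ∈ˡ neg L

-- Only `pos` is compared, as failure need not persist upwards.
_≼_ : Label → Label → Set
L ≼ M = pos L ⊆ˡ pos M

root : ∀ {n} → Vec W₁ n
root = replicate _ w₀

rootR : ∀ {n} (x : Vec W₁ n) → root R x
rootR []       = []
rootR (w₀ ∷ x) = here ∷ rootR x
rootR (w₋ ∷ x) = w₀w₋ ∷ rootR x
rootR (w₊ ∷ x) = w₀w₊ ∷ rootR x

R-root : ∀ {n} {x y : Vec W₁ n} → x R y → y ≡ root → x ≡ root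
R-root {x = x} r refl = R-antisym r (rootR x)

Rrefl : ∀ {n} {x : Vec W₁ n} → x R x
Rrefl = Pointwise.refl here

_isVar?_ : ∀ χ p → Dec (var p ≡ χ)
var q   isVar? p = map′ (cong var) (λ { refl → refl }) (p ℕ.≟ q)
⊥ᶠ      isVar? p = no λ ()
(_ ∧ _) isVar? p = no λ ()
(_ ∨ _) isVar? p = no λ ()
(_ ⇒ _) isVar? p = no λ ()

var∈? : ∀ p Γ → Dec (var p ∈ˡ Γ)
var∈? p = any? (_isVar? p)

-- A labelling whose root label need only be justified for the formulas in
-- obligations, so that the successors of the root can be added one by one.
record Labelling (top L : Label) (obligations : List Formula) : Set where
  field
    dim        : ℕ
    ℓ          : Vec W₁ dim → Label
    at-root    : ℓ root ≡ L
    mono       : ∀ {x y} → x R y → ℓ x ≼ ℓ y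
    below      : ∀ x → ℓ x ≼ top
    supported  : ∀ x {χ} → χ ∈ˡ pos (ℓ x) → Supported (ℓ x) χ
    refuted₀   : ∀ {χ} → χ ∈ˡ obligations → ∃[ y ] Refuted (ℓ y) χ
    refuted    : ∀ {x χ} → x ≢ root → χ ∈ˡ neg (ℓ x) → ∃[ y ] x R y × Refuted (ℓ y) χ

Model : Label → Label → Set
Model top L = Labelling top L (neg L)

module Truth {top L} (M : Model top L) where
  open Labelling M

  refutedAbove : ∀ x {χ} → χ ∈ˡ neg (ℓ x) → ∃[ y ] x R y × Refuted (ℓ y) χ
  refutedAbove x χ∈ with x ≟ᵛ root
  ... | yes refl  = let y , r = refuted₀ (subst (λ l → _ ∈ˡ neg l) at-root χ∈) in y , rootR y , r
  ... | no x≢root = refuted x≢root χ∈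

  P? : ∀ p x → Dec (var p ∈ˡ pos (ℓ x))
  P? p x = var∈? p (pos (ℓ x))

  V : Valuation (𝔉 dim)
  V = decValuation (𝔉 dim) P? (λ p x≤y → mono x≤y)

  V-⇔ : ∀ p x → T (Valuation.holds V p x) ⇔ (var p ∈ˡ pos (ℓ x))
  V-⇔ = decValuation-⇔ (𝔉 dim) P? (λ p x≤y → mono x≤y)

  mutual
    pos-forced : ∀ χ {x} → χ ∈ˡ pos (ℓ x) → Forces (𝔉 dim) V x χ
    pos-forced (var p) {x} χ∈ = from (V-⇔ p x) χ∈
    pos-forced ⊥ᶠ      {x} χ∈ = supported x χ∈
    pos-forced (φ ∧ ψ) {x} χ∈ = Product.map (pos-forced φ) (pos-forced ψ) (supported x χ∈)
    pos-forced (φ ∨ ψ) {x} χ∈ = Sum.map (pos-forced φ) (pos-forced ψ) (supported x χ∈)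
    pos-forced (φ ⇒ ψ) {x} χ∈ y x≤y yφ with supported y (mono x≤y χ∈)
    ... | inj₁ φ∈ = contradiction yφ (neg-unforced φ φ∈)
    ... | inj₂ ψ∈ = pos-forced ψ ψ∈

    neg-unforced : ∀ χ {x} → χ ∈ˡ neg (ℓ x) → ¬ Forces (𝔉 dim) V x χ
    neg-unforced χ {x} χ∈ f =
      let y , x≤y , r = refutedAbove x χ∈ in refuted-unforced χ r (persist χ x≤y f)

    refuted-unforced : ∀ χ {x} → Refuted (ℓ x) χ → ¬ Forces (𝔉 dim) V x χ
    refuted-unforced (var p) {x} r f              = r (to (V-⇔ p x) f)
    refuted-unforced ⊥ᶠ      r f                  = f
    refuted-unforced (φ ∧ ψ) (inj₁ φ∈) (f , _)    = neg-unforced φ φ∈ f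
    refuted-unforced (φ ∧ ψ) (inj₂ ψ∈) (_ , g)    = neg-unforced ψ ψ∈ g
    refuted-unforced (φ ∨ ψ) (φ∈ , _)  (inj₁ f)   = neg-unforced φ φ∈ f
    refuted-unforced (φ ∨ ψ) (_ , ψ∈)  (inj₂ g)   = neg-unforced ψ ψ∈ g
    refuted-unforced (φ ⇒ ψ) {x} (φ∈ , ψ∈) f      =
      neg-unforced ψ ψ∈ (f x Rrefl (pos-forced φ φ∈))

  root-unforced : ∀ {χ} → χ ∈ˡ neg L → ¬ Forces (𝔉 dim) V root χ
  root-unforced {χ} χ∈ = neg-unforced χ (subst (λ l → χ ∈ˡ neg l) (sym at-root) χ∈)

-- Gluing labelled cubes

module _ {n : ℕ} where
  takeR : ∀ m {x y : Vec W₁ (m + n)} → x R y → take m x R take m y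
  takeR zero    _       = []
  takeR (suc m) {_ ∷ _} {_ ∷ _} (r ∷ rs) = r ∷ takeR m rs

  dropR : ∀ m {x y : Vec W₁ (m + n)} → x R y → drop m x R drop m y
  dropR zero    r        = r
  dropR (suc m) {_ ∷ _} {_ ∷ _} (r ∷ rs) = dropR m rs

  take-++ : ∀ {m} (u : Vec W₁ m) (v : Vec W₁ n) → take m (u Vec.++ v) ≡ u
  take-++ {m} u v = Vec.++-injectiveˡ _ u (Vec.take++drop≡id m (u Vec.++ v))

  drop-++ : ∀ {m} (u : Vec W₁ m) (v : Vec W₁ n) → drop m (u Vec.++ v) ≡ v
  drop-++ {m} u v = Vec.++-injectiveʳ _ u (Vec.take++drop≡id m (u Vec.++ v))

  R-++ : ∀ m (x : Vec W₁ (m + n)) {u v} → take m x R u → drop m x R v → x R (u Vec.++ v)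
  R-++ m x r s = subst (_R _) (Vec.take++drop≡id m x) (Pointwise.++⁺ r s)

take-root : ∀ m {n} → take m (root {m + n}) ≡ root
take-root zero    = refl
take-root (suc m) = cong (w₀ ∷_) (take-root m)

drop-root : ∀ m {n} → drop m (root {m + n}) ≡ root
drop-root zero    = refl
drop-root (suc m) = drop-root m

-- Grafts `M′` above the root of `M`, so that `χ` is refuted on the new branch; `L ≼ L′` makes the
-- passage from the root into the branch monotone.
module Combine {top L L′ : Label} {obligations : List Formula} {χ : Formula}
               (top-refuted : ∀ {χ} → χ ∈ˡ neg top → Refuted top χ)
               (top-supported : ∀ {χ} → χ ∈ˡ pos top → Supported top χ)
               (M : Labelling top L obligations) (M′ : Model top L′)
               (L≼L′ : L ≼ L′) (L′-refutes : Refuted L′ χ) where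
  private
    module M  = Labelling M
    module M′ = Labelling M′

  -- The first coordinate of u is a trigger: it lets the root label of M′ be
  -- reached.  Once both u and v have left the root, everything collapses to top.
  glue : Vec W₁ (suc M′.dim) → Vec W₁ M.dim → Label
  glue u v with u ≟ᵛ root | v ≟ᵛ root
  ... | yes _ | _     = M.ℓ v
  ... | no _  | yes _ = M′.ℓ (tail u)
  ... | no _  | no _  = top

  glue-untriggered : ∀ {u} v → u ≡ root → glue u v ≡ M.ℓ v
  glue-untriggered {u} v u≡ with u ≟ᵛ root | v ≟ᵛ root
  ... | yes _ | _ = refl
  ... | no u≢ | _ = contradiction u≡ u≢

  glue-triggered : ∀ {u v} → u ≢ root → v ≡ root → glue u v ≡ M′.ℓ (tail u)
  glue-triggered {u} {v} u≢ v≡ with u ≟ᵛ root | v ≟ᵛ root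
  ... | yes u≡ | _      = contradiction u≡ u≢
  ... | no _   | yes _  = refl
  ... | no _   | no v≢  = contradiction v≡ v≢

  glue-mono : ∀ {u u₁ v v₁} → u R u₁ → v R v₁ → glue u v ≼ glue u₁ v₁
  glue-mono {u} {u₁} {v} {v₁} r s
    with u ≟ᵛ root | v ≟ᵛ root
       | u₁ ≟ᵛ root | v₁ ≟ᵛ root
  ... | yes _ | _      | yes _   | _      = M.mono s
  -- Entering the branch: `v₁ ≡ root` forces `v ≡ root`, so the label left behind is `L`, which `L′`
  -- extends.
  ... | yes _ | _      | no _    | yes v₁≡ rewrite R-root s v₁≡ | M.at-root =
    M′.mono (rootR (tail u₁)) ∘ subst (λ l → L ≼ l) (sym M′.at-root) L≼L′
  ... | yes _ | _      | no _    | no _   = M.below v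
  ... | no u≢ | _      | yes u₁≡ | _      = contradiction (R-root r u₁≡) u≢
  ... | no _  | yes _  | no _    | yes _  = M′.mono (Rtail r)
    where
    Rtail : ∀ {n} {x y : Vec W₁ (suc n)} → x R y → tail x R tail y
    Rtail (_ ∷ r) = r
  ... | no _  | yes _  | no _    | no _   = M′.below (tail u)
  ... | no _  | no v≢  | no _    | yes v₁≡ = contradiction (R-root s v₁≡) v≢
  ... | no _  | no _   | no _    | no _   = id

  glue-below : ∀ u v → glue u v ≼ top
  glue-below u v with u ≟ᵛ root | v ≟ᵛ root
  ... | yes _ | _     = M.below v
  ... | no _  | yes _ = M′.below (tail u)
  ... | no _  | no _  = id

  glue-supported : ∀ u v {χ} → χ ∈ˡ pos (glue u v) → Supported (glue u v) χ
  glue-supported u v with u ≟ᵛ root | v ≟ᵛ root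
  ... | yes _ | _     = M.supported v
  ... | no _  | yes _ = M′.supported (tail u)
  ... | no _  | no _  = top-supported

  -- The witness stays in the same piece: `M` moves `v`, `M′` moves the tail of `u`, and `top`
  -- refutes on the spot. The common root is excluded, because there only the obligations have
  -- witnesses.
  glue-refuted : ∀ u v {χ} → ¬ (u ≡ root × v ≡ root) → χ ∈ˡ neg (glue u v) →
                 ∃[ u₁ ] ∃[ v₁ ] u R u₁ × v R v₁ × Refuted (glue u₁ v₁) χ
  glue-refuted u v {χ} nonroot χ∈ with u ≟ᵛ root | v ≟ᵛ root in v-eq
  ... | yes u≡ | yes v≡ = contradiction (u≡ , v≡) nonroot
  ... | yes u≡ | no v≢  = let v₁ , s , ref = M.refuted v≢ χ∈ in
    u , v₁ , Rrefl , s , subst (λ l → Refuted l χ) (sym (glue-untriggered v₁ u≡)) ref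
  ... | no u≢  | yes v≡ with u
  ...   | b ∷ u′ = let u₁ , r , ref = Truth.refutedAbove M′ u′ χ∈ in
    b ∷ u₁ , v , here ∷ r , Rrefl ,
    subst (λ l → Refuted l χ) (sym (glue-triggered (u≢ ∘ R-root (here ∷ r)) v≡)) ref
  glue-refuted u v {χ} nonroot χ∈ | no u≢ | no v≢ =
    u , v , Rrefl , Rrefl , subst (λ l → Refuted l χ) (sym glue-top) (top-refuted χ∈)
    where
    glue-top : glue u v ≡ top
    glue-top with u ≟ᵛ root | v ≟ᵛ root
    ... | yes u≡ | _      = contradiction u≡ u≢
    ... | no _   | yes v≡ = contradiction v≡ v≢
    ... | no _   | no _   = refl

  private
    m : ℕ
    m = suc M′.dim

  refuted-++ : ∀ {ψ} u v → Refuted (glue u v) ψ →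
               Refuted (glue (take m (u Vec.++ v)) (drop m (u Vec.++ v))) ψ
  refuted-++ u v ref rewrite take-++ u v | drop-++ u v = ref

  combine : Labelling top L (χ ∷ obligations)
  combine = record
    { dim       = m + M.dim
    ; ℓ         = λ x → glue (take m x) (drop m x)
    ; at-root   = at-root
    ; mono      = λ r → glue-mono (takeR m r) (dropR m r)
    ; below     = λ x → glue-below (take m x) (drop m x)
    ; supported = λ x → glue-supported (take m x) (drop m x)
    ; refuted₀  = λ
      -- `pressed` moves the trigger alone, which leads to the root of `M′` and its label `L′`.
      { (here refl) → pressed Vec.++ root {M.dim} , refuted-++ pressed root
          (subst (λ l → Refuted l χ)
                 (sym (trans (glue-triggered {pressed} {root} (λ ()) refl) M′.at-root))
                 L′-refutes)
      ; (there ψ∈) → let y , ref = M.refuted₀ ψ∈ in root {m} Vec.++ y , refuted-++ root y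
          (subst (λ l → Refuted l _) (sym (glue-untriggered y refl)) ref)
      }
    ; refuted   = λ {x} x≢root ψ∈ →
        let u , v , r , s , ref = glue-refuted (take m x) (drop m x) (x≢root ∘ ++-root x) ψ∈ in
        u Vec.++ v , R-++ m x r s , refuted-++ u v ref
    }
    where
    pressed : Vec W₁ m
    pressed = w₊ ∷ root
    at-root : glue (take m root) (drop m root) ≡ L
    at-root = trans (glue-untriggered (drop m root) (take-root m))
                    (trans (cong M.ℓ (drop-root m)) M.at-root)
    ++-root : ∀ x → take m x ≡ root × drop m x ≡ root → x ≡ root
    ++-root x (eq₁ , eq₂) = trans (sym (Vec.take++drop≡id m x)) (trans
      (cong₂ Vec._++_ (trans eq₁ (sym (take-root m))) (trans eq₂ (sym (drop-root m))))
      (Vec.take++drop≡id m root))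

-- Completeness relative to a classical assignment

immediate : Formula → List Formula
immediate (var _) = []
immediate ⊥ᶠ      = []
immediate (φ ∧ ψ) = φ ∷ ψ ∷ []
immediate (φ ∨ ψ) = φ ∷ ψ ∷ []
immediate (φ ⇒ ψ) = φ ∷ ψ ∷ []

module Completeness {L : Logic} (ipc⊆L : IPC ⊆ L)
                    (Φ : List Formula) (v : ℕ → Bool) where
  open NaturalDeduction ipc⊆L

  -- `𝔉 0` is a single point, so forcing there is classical truth under `v`, and `top` is the
  -- classical theory of `v` within `Φ`.
  vᵐᵃˣ : Valuation (𝔉 0)
  vᵐᵃˣ = record { holds = λ p _ → v p ; upward = λ _ _ t → t }

  True : Formula → Set
  True = Forces (𝔉 0) vᵐᵃˣ []

  true? : ∀ χ → Dec (True χ)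
  true? χ = forces? vᵐᵃˣ χ []

  top : Label
  top = label (filter true? Φ) (filter (¬? ∘ true?) Φ)

  module _ (closed : ∀ {χ} → χ ∈ˡ Φ → immediate χ ⊆ˡ Φ)
           (decided : ∀ {p} → var p ∈ˡ Φ → [] ⊢ (if v p then ¬ᶠ ¬ᶠ var p else ¬ᶠ var p))
           where

    closed-∧ : ∀ {φ ψ} → φ ∧ ψ ∈ˡ Φ → φ ∈ˡ Φ × ψ ∈ˡ Φ
    closed-∧ χ∈ = closed χ∈ (here refl) , closed χ∈ (there (here refl))

    closed-∨ : ∀ {φ ψ} → φ ∨ ψ ∈ˡ Φ → φ ∈ˡ Φ × ψ ∈ˡ Φ
    closed-∨ χ∈ = closed χ∈ (here refl) , closed χ∈ (there (here refl))

    closed-⇒ : ∀ {φ ψ} → φ ⇒ ψ ∈ˡ Φ → φ ∈ˡ Φ × ψ ∈ˡ Φ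
    closed-⇒ χ∈ = closed χ∈ (here refl) , closed χ∈ (there (here refl))

    top-pos⁺ : ∀ {χ} → χ ∈ˡ Φ → True χ → χ ∈ˡ pos top
    top-pos⁺ = ∈-filter⁺ true?

    top-neg⁺ : ∀ {χ} → χ ∈ˡ Φ → ¬ True χ → χ ∈ˡ neg top
    top-neg⁺ = ∈-filter⁺ (¬? ∘ true?)

    Literal : Formula → Set
    Literal χ = (True χ × [] ⊢ ¬ᶠ ¬ᶠ χ) ⊎ (¬ True χ × [] ⊢ ¬ᶠ χ)

    -- Kalmár's lemma, with `¬ ¬ χ` for true formulas, so that each step is intuitionistic.
    literal : ∀ χ → χ ∈ˡ Φ → Literal χ
    literal (var p) χ∈ with v p | decided χ∈
    ... | true  | d = inj₁ (_ , d)
    ... | false | d = inj₂ (id , d)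
    literal ⊥ᶠ _ = inj₂ (id , ⇒-intro hyp₀)
    literal (φ ∧ ψ) χ∈ with literal φ (proj₁ (closed-∧ χ∈)) | literal ψ (proj₂ (closed-∧ χ∈))
    ... | inj₁ (f , d) | inj₁ (g , e) = inj₁ ((f , g) , ⇒-intro
      (mp (weaken₁ d) (⇒-intro (mp (weaken₁ (weaken₁ e))
        (⇒-intro (mp (premise (there (there (here refl)))) (∧-intro hyp₁ hyp₀)))))))
    ... | inj₂ (¬f , d) | _ = inj₂ (¬f ∘ proj₁ , ⇒-intro (mp (weaken₁ d) (∧-elimˡ hyp₀)))
    ... | inj₁ _ | inj₂ (¬g , e) = inj₂ (¬g ∘ proj₂ , ⇒-intro (mp (weaken₁ e) (∧-elimʳ hyp₀)))
    literal (φ ∨ ψ) χ∈ with literal φ (proj₁ (closed-∨ χ∈)) | literal ψ (proj₂ (closed-∨ χ∈))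
    ... | inj₁ (f , d) | _ = inj₁ (inj₁ f , ⇒-intro
      (mp (weaken₁ d) (⇒-intro (mp hyp₁ (∨-introˡ hyp₀)))))
    ... | inj₂ _ | inj₁ (g , e) = inj₁ (inj₂ g , ⇒-intro
      (mp (weaken₁ e) (⇒-intro (mp hyp₁ (∨-introʳ hyp₀)))))
    ... | inj₂ (¬f , d) | inj₂ (¬g , e) = inj₂ ([ ¬f , ¬g ]′ , ⇒-intro
      (∨-elim hyp₀ (mp (weaken₁ (weaken₁ d)) hyp₀) (mp (weaken₁ (weaken₁ e)) hyp₀)))
    literal (φ ⇒ ψ) χ∈ with literal φ (proj₁ (closed-⇒ χ∈)) | literal ψ (proj₂ (closed-⇒ χ∈))
    ... | inj₂ (¬f , d) | _ = inj₁ ((λ { [] _ f → ⊥-elim (¬f f) }) , ⇒-intro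
      (mp hyp₀ (⇒-intro (⊥-elimᶠ (mp (weaken₁ (weaken₁ d)) hyp₀)))))
    ... | inj₁ _ | inj₁ (g , e) = inj₁ ((λ { [] _ _ → g }) , ⇒-intro
      (mp (weaken₁ e) (⇒-intro (mp hyp₁ (⇒-intro hyp₁)))))
    ... | inj₁ (f , d) | inj₂ (¬g , e) = inj₂ ((λ h → ¬g (h [] [] f)) , ⇒-intro
      (mp (weaken₁ d) (⇒-intro (mp (weaken₁ (weaken₁ e)) (mp hyp₁ hyp₀)))))

    top-supported : ∀ {χ} → χ ∈ˡ pos top → Supported top χ
    top-supported {χ} χ∈ = go χ (∈-filter⁻ true? χ∈)
      where
      go : ∀ χ → χ ∈ˡ Φ × True χ → Supported top χ
      go (var p) _ = _
      go (φ ∧ ψ) (χ∈ , f , g) = let φ∈ , ψ∈ = closed-∧ χ∈ in top-pos⁺ φ∈ f , top-pos⁺ ψ∈ g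
      go (φ ∨ ψ) (χ∈ , f) = let φ∈ , ψ∈ = closed-∨ χ∈ in Sum.map (top-pos⁺ φ∈) (top-pos⁺ ψ∈) f
      go (φ ⇒ ψ) (χ∈ , h) with true? φ
      ... | yes f = inj₂ (top-pos⁺ (proj₂ (closed-⇒ χ∈)) (h [] [] f))
      ... | no ¬f = inj₁ (top-neg⁺ (proj₁ (closed-⇒ χ∈)) ¬f)

    top-refuted : ∀ {χ} → χ ∈ˡ neg top → Refuted top χ
    top-refuted {χ} χ∈ = go χ (∈-filter⁻ (¬? ∘ true?) χ∈)
      where
      go : ∀ χ → χ ∈ˡ Φ × ¬ True χ → Refuted top χ
      go (var p) (_ , ¬f) p∈ = ¬f (proj₂ (∈-filter⁻ true? {xs = Φ} p∈))
      go ⊥ᶠ _ = _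
      go (φ ∧ ψ) (χ∈ , ¬f) with true? φ
      ... | yes f = inj₂ (top-neg⁺ (proj₂ (closed-∧ χ∈)) (¬f ∘ (f ,_)))
      ... | no ¬g = inj₁ (top-neg⁺ (proj₁ (closed-∧ χ∈)) ¬g)
      go (φ ∨ ψ) (χ∈ , ¬f) = let φ∈ , ψ∈ = closed-∨ χ∈ in
        top-neg⁺ φ∈ (¬f ∘ inj₁) , top-neg⁺ ψ∈ (¬f ∘ inj₂)
      go (φ ⇒ ψ) (χ∈ , ¬f) with true? φ
      ... | yes f = top-pos⁺ (proj₁ (closed-⇒ χ∈)) f ,
                    top-neg⁺ (proj₂ (closed-⇒ χ∈)) (λ g → ¬f λ { [] _ _ → g })
      ... | no ¬g = ⊥-elim (¬f λ { [] _ g → ⊥-elim (¬g g) })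

    record Partition (Γ todo Δ : List Formula) : Set where
      field
        cover  : ∀ {χ} → χ ∈ˡ Φ → χ ∈ˡ Γ ⊎ χ ∈ˡ todo ⊎ χ ∈ˡ Δ
        Γ⊆Φ    : Γ ⊆ˡ Φ
        todo⊆Φ : todo ⊆ˡ Φ
        Δ⊆Φ    : Δ ⊆ˡ Φ

    ∷⊆ : ∀ {χ Γ} → χ ∈ˡ Φ → Γ ⊆ˡ Φ → χ ∷ Γ ⊆ˡ Φ
    ∷⊆ χ∈ Γ⊆ (here refl) = χ∈
    ∷⊆ χ∈ Γ⊆ (there φ∈)  = Γ⊆ φ∈

    moveˡ : ∀ {χ Γ todo Δ} → Partition Γ (χ ∷ todo) Δ → Partition (χ ∷ Γ) todo Δ
    moveˡ P = record
      { cover  = λ χ∈ → case-cover (P.cover χ∈)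
      ; Γ⊆Φ    = ∷⊆ (P.todo⊆Φ (here refl)) P.Γ⊆Φ
      ; todo⊆Φ = P.todo⊆Φ ∘ there
      ; Δ⊆Φ    = P.Δ⊆Φ
      }
      where
      module P = Partition P
      case-cover : ∀ {χ φ Γ todo Δ} → φ ∈ˡ Γ ⊎ φ ∈ˡ χ ∷ todo ⊎ φ ∈ˡ Δ →
                   φ ∈ˡ χ ∷ Γ ⊎ φ ∈ˡ todo ⊎ φ ∈ˡ Δ
      case-cover (inj₁ i)                  = inj₁ (there i)
      case-cover (inj₂ (inj₁ (here refl))) = inj₁ (here refl)
      case-cover (inj₂ (inj₁ (there i)))   = inj₂ (inj₁ i)
      case-cover (inj₂ (inj₂ i))           = inj₂ (inj₂ i)

    moveʳ : ∀ {χ Γ todo Δ} → Partition Γ (χ ∷ todo) Δ → Partition Γ todo (χ ∷ Δ)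
    moveʳ P = record
      { cover  = λ χ∈ → case-cover (P.cover χ∈)
      ; Γ⊆Φ    = P.Γ⊆Φ
      ; todo⊆Φ = P.todo⊆Φ ∘ there
      ; Δ⊆Φ    = ∷⊆ (P.todo⊆Φ (here refl)) P.Δ⊆Φ
      }
      where
      module P = Partition P
      case-cover : ∀ {χ φ Γ todo Δ} → φ ∈ˡ Γ ⊎ φ ∈ˡ χ ∷ todo ⊎ φ ∈ˡ Δ →
                   φ ∈ˡ Γ ⊎ φ ∈ˡ todo ⊎ φ ∈ˡ χ ∷ Δ
      case-cover (inj₁ i)                  = inj₁ i
      case-cover (inj₂ (inj₁ (here refl))) = inj₂ (inj₂ (here refl))
      case-cover (inj₂ (inj₁ (there i)))   = inj₂ (inj₁ i)
      case-cover (inj₂ (inj₂ i))           = inj₂ (inj₂ (there i))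

    -- The node refuting an implication keeps `Γ`, adds the antecedent `φ`, and decides the other
    -- denied formulas anew, since failure need not persist.
    restart : ∀ {φ Γ Δ todo} → Partition Γ [] Δ → Δ ↭ φ ∷ todo → Partition (φ ∷ Γ) todo []
    restart P Δ↭ = moveˡ record
      { cover  = Sum.map id (λ { (inj₂ i) → inj₁ (∈-resp-↭ Δ↭ i) }) ∘ P.cover
      ; Γ⊆Φ    = P.Γ⊆Φ
      ; todo⊆Φ = P.Δ⊆Φ ∘ ∈-resp-↭ (↭-sym Δ↭)
      ; Δ⊆Φ    = λ ()
      }
      where module P = Partition P

    Countermodel : List Formula → (Label → Set) → Set
    Countermodel Γ P = ∃[ M ] Γ ⊆ˡ pos M × P M × Model top M

    -- The bound on length Δ makes the search terminate: refuting φ ⇒ ψ moves φ from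
    -- Δ to Γ.
    Decision : ℕ → Set
    Decision m = ∀ {Γ Δ} → length Δ < m → Partition Γ [] Δ →
                 (Γ ⊢ ⋁ Δ) ⊎ Countermodel Γ (λ M → Δ ⊆ˡ neg M)

    -- Cut on every formula of todo: if all leaves are derivable, so is the root.
    saturate : ∀ {m} → Decision m → ∀ {ψ} → ψ ∈ˡ Φ → ∀ todo {Γ Δ} →
               length todo + length Δ < m → Partition Γ todo Δ →
               (Γ ⊢ ψ ∨ ⋁ Δ) ⊎ Countermodel Γ (λ M → ψ ∈ˡ neg M)
    saturate decide ψ∈Φ [] <m P with Partition.cover P ψ∈Φ
    ... | inj₁ ψ∈Γ        = inj₁ (∨-introˡ (premise ψ∈Γ))
    ... | inj₂ (inj₂ ψ∈Δ) = Sum.map ∨-introʳ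
      (λ (M , Γ⊆ , Δ⊆ , model) → M , Γ⊆ , Δ⊆ ψ∈Δ , model) (decide <m P)
    saturate {m} decide ψ∈Φ (χ ∷ todo) {Γ} {Δ} <m P
      with saturate decide ψ∈Φ todo (ℕ.<-trans (ℕ.n<1+n _) <m) (moveˡ P)
         | saturate decide ψ∈Φ todo
             (subst (_< m) (sym (ℕ.+-suc (length todo) (length Δ))) <m) (moveʳ P)
    ... | inj₂ (M , Γ⊆ , rest) | _ = inj₂ (M , Γ⊆ ∘ there , rest)
    ... | inj₁ _ | inj₂ model = inj₂ model
    -- The second branch yields `ψ`, `χ` or `⋁ Δ`; under `χ` the first branch takes over.
    ... | inj₁ d | inj₁ e = inj₁ (∨-elim e (∨-introˡ hyp₀) (∨-elim hyp₀
      (weaken (∷⁺ʳ χ there) d) (∨-introʳ hyp₀)))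

    extract : ∀ {φ : Formula} {Δ} → φ ∈ˡ Δ → ∃[ rest ] Δ ↭ φ ∷ rest
    extract {φ} φ∈Δ with ∈-∃++ φ∈Δ
    ... | ys , zs , refl = ys ++ zs , shift φ ys zs

    traverse : ∀ {A : Set} {P : Formula → Set} xs → (∀ {χ} → χ ∈ˡ xs → A ⊎ P χ) →
               A ⊎ (∀ {χ} → χ ∈ˡ xs → P χ)
    traverse []       f = inj₂ λ ()
    traverse (x ∷ xs) f with f (here refl) | traverse xs (f ∘ there)
    ... | inj₁ a | _      = inj₁ a
    ... | inj₂ _ | inj₁ a = inj₁ a
    ... | inj₂ p | inj₂ g = inj₂ λ { (here refl) → p ; (there i) → g i }

    -- A local defect of the label with `pos` equal to `Γ` and `neg` equal to `Δ` is itself a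
    -- derivation of `⋁ Δ` from `Γ`.
    module Step {m} (decide : Decision m) {Γ Δ} (<m : length Δ < suc m) (P : Partition Γ [] Δ) where
      open Partition P

      M : Label
      M = label Γ Δ

      split : ∀ {χ} → χ ∈ˡ Φ → χ ∈ˡ Γ ⊎ χ ∈ˡ Δ
      split χ∈ = Sum.map id (λ { (inj₂ i) → i }) (cover χ∈)

      check-pos : ∀ {χ} → χ ∈ˡ Γ → (Γ ⊢ ⋁ Δ) ⊎ (Supported M χ × χ ∈ˡ pos top)
      check-pos {χ} χ∈Γ with literal χ (Γ⊆Φ χ∈Γ)
      -- `L` proves the negation of a classically false formula, so `Γ` is inconsistent; this keeps
      -- the surviving labels below `top`.
      ... | inj₂ (_ , d) = inj₁ (⊥-elimᶠ (mp (weaken (λ ()) d) (premise χ∈Γ)))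
      ... | inj₁ (χ-true , _) = Sum.map id (_, top-pos⁺ (Γ⊆Φ χ∈Γ) χ-true) (supported χ χ∈Γ)
        where
        supported : ∀ χ → χ ∈ˡ Γ → (Γ ⊢ ⋁ Δ) ⊎ Supported M χ
        supported (var p) _ = inj₂ _
        supported ⊥ᶠ      ⊥∈ = inj₁ (⊥-elimᶠ (premise ⊥∈))
        supported (φ ∧ ψ) ∧∈ with closed-∧ (Γ⊆Φ ∧∈)
        ... | φ∈Φ , ψ∈Φ with split φ∈Φ | split ψ∈Φ
        ...   | inj₁ φ∈Γ | inj₁ ψ∈Γ = inj₂ (φ∈Γ , ψ∈Γ)
        ...   | inj₂ φ∈Δ | _        = inj₁ (⋁-intro φ∈Δ (∧-elimˡ (premise ∧∈)))
        ...   | inj₁ _   | inj₂ ψ∈Δ = inj₁ (⋁-intro ψ∈Δ (∧-elimʳ (premise ∧∈)))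
        supported (φ ∨ ψ) ∨∈ with closed-∨ (Γ⊆Φ ∨∈)
        ... | φ∈Φ , ψ∈Φ with split φ∈Φ | split ψ∈Φ
        ...   | inj₁ φ∈Γ | _        = inj₂ (inj₁ φ∈Γ)
        ...   | inj₂ _   | inj₁ ψ∈Γ = inj₂ (inj₂ ψ∈Γ)
        ...   | inj₂ φ∈Δ | inj₂ ψ∈Δ =
          inj₁ (∨-elim (premise ∨∈) (⋁-intro φ∈Δ hyp₀) (⋁-intro ψ∈Δ hyp₀))
        supported (φ ⇒ ψ) ⇒∈ with closed-⇒ (Γ⊆Φ ⇒∈)
        ... | φ∈Φ , ψ∈Φ with split φ∈Φ | split ψ∈Φ
        ...   | inj₂ φ∈Δ | _        = inj₂ (inj₁ φ∈Δ)
        ...   | inj₁ _   | inj₁ ψ∈Γ = inj₂ (inj₂ ψ∈Γ)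
        ...   | inj₁ φ∈Γ | inj₂ ψ∈Δ = inj₁ (⋁-intro ψ∈Δ (mp (premise ⇒∈) (premise φ∈Γ)))

      Refutable : Formula → Set
      Refutable χ = Refuted M χ ⊎ Countermodel Γ (λ M′ → Refuted M′ χ)

      check-neg : ∀ χ → χ ∈ˡ Δ → (Γ ⊢ ⋁ Δ) ⊎ Refutable χ
      check-neg (var p) p∈Δ with var∈? p Γ
      ... | yes p∈Γ = inj₁ (⋁-intro p∈Δ (premise p∈Γ))
      ... | no p∉Γ  = inj₂ (inj₁ p∉Γ)
      check-neg ⊥ᶠ _ = inj₂ (inj₁ _)
      check-neg (φ ∧ ψ) ∧∈ with closed-∧ (Δ⊆Φ ∧∈)
      ... | φ∈Φ , ψ∈Φ with split φ∈Φ | split ψ∈Φ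
      ...   | inj₂ φ∈Δ | _        = inj₂ (inj₁ (inj₁ φ∈Δ))
      ...   | inj₁ _   | inj₂ ψ∈Δ = inj₂ (inj₁ (inj₂ ψ∈Δ))
      ...   | inj₁ φ∈Γ | inj₁ ψ∈Γ = inj₁ (⋁-intro ∧∈ (∧-intro (premise φ∈Γ) (premise ψ∈Γ)))
      check-neg (φ ∨ ψ) ∨∈ with closed-∨ (Δ⊆Φ ∨∈)
      ... | φ∈Φ , ψ∈Φ with split φ∈Φ | split ψ∈Φ
      ...   | inj₁ φ∈Γ | _        = inj₁ (⋁-intro ∨∈ (∨-introˡ (premise φ∈Γ)))
      ...   | inj₂ _   | inj₁ ψ∈Γ = inj₁ (⋁-intro ∨∈ (∨-introʳ (premise ψ∈Γ)))
      ...   | inj₂ φ∈Δ | inj₂ ψ∈Δ = inj₂ (inj₁ (φ∈Δ , ψ∈Δ))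
      check-neg (φ ⇒ ψ) ⇒∈ with closed-⇒ (Δ⊆Φ ⇒∈)
      ... | φ∈Φ , ψ∈Φ with split φ∈Φ | split ψ∈Φ
      ...   | _        | inj₁ ψ∈Γ = inj₁ (⋁-intro ⇒∈ (⇒-intro (weaken₁ (premise ψ∈Γ))))
      ...   | inj₁ φ∈Γ | inj₂ ψ∈Δ = inj₂ (inj₁ (φ∈Γ , ψ∈Δ))
      -- The label itself does not refute the implication, as `φ` is denied; a new node must assume
      -- `φ` and deny `ψ`.
      ...   | inj₂ φ∈Δ | inj₂ _   with extract φ∈Δ
      ...     | todo , Δ↭ with saturate decide ψ∈Φ todo todo<m (restart P Δ↭)
        where
        todo<m : length todo + 0 < m
        todo<m = subst (_< m) (sym (ℕ.+-identityʳ (length todo)))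
          (ℕ.≤-pred (subst (_< suc m) (↭-length Δ↭) <m))
      -- `restart` begins with nothing denied, so the second disjunct is the empty `⋁`, that is
      -- `⊥ᶠ`.
      ...       | inj₁ d = inj₁ (⋁-intro ⇒∈ (⇒-intro (∨-elim d hyp₀ (⊥-elimᶠ hyp₀))))
      ...       | inj₂ (M′ , Γ⊆ , ψ∈ , model) =
                  inj₂ (inj₂ (M′ , Γ⊆ ∘ there , (Γ⊆ (here refl) , ψ∈) , model))

      -- Starts from the one-point cube labelled `M`; each formula of `xs` that comes with a
      -- countermodel of its own has it grafted on.
      build : (∀ {χ} → χ ∈ˡ Γ → Supported M χ × χ ∈ˡ pos top) →
              ∀ xs → (∀ {χ} → χ ∈ˡ xs → Refutable χ) → Labelling top M xs
      build Γ-ok [] _ = record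
        { dim       = 0
        ; ℓ         = const M
        ; at-root   = refl
        ; mono      = λ _ → id
        ; below     = λ _ → proj₂ ∘ Γ-ok
        ; supported = λ _ → proj₁ ∘ Γ-ok
        ; refuted₀  = λ ()
        ; refuted   = λ { {[]} x≢root → contradiction refl x≢root }
        }
      build Γ-ok (χ ∷ xs) refutable with build Γ-ok xs (refutable ∘ there) | refutable (here refl)
      ... | N | inj₁ ref = record
        { Labelling N hiding (refuted₀)
        ; refuted₀ = λ
          { (here refl) → root , subst (λ l → Refuted l χ) (sym (Labelling.at-root N)) ref
          ; (there ψ∈)  → Labelling.refuted₀ N ψ∈
          }
        }
      ... | N | inj₂ (M′ , Γ⊆ , ref , model) =
        Combine.combine top-refuted top-supported N model Γ⊆ ref

      step : (Γ ⊢ ⋁ Δ) ⊎ Countermodel Γ (λ M′ → Δ ⊆ˡ neg M′)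
      step with traverse Γ check-pos | traverse Δ (check-neg _)
      ... | inj₁ d    | _      = inj₁ d
      ... | inj₂ _    | inj₁ d = inj₁ d
      ... | inj₂ Γ-ok | inj₂ refutable = inj₂ (M , id , id , build Γ-ok Δ refutable)

    decide : ∀ m → Decision m
    decide (suc m) <m P = Step.step (decide m) <m P

    complete : ∀ {θ} → θ ∈ˡ Φ → θ ∈ Cheq → [] ⊢ θ
    complete {θ} θ∈Φ θ∈Cheq with saturate (decide _) θ∈Φ Φ {[]} {[]} (ℕ.n<1+n _) record
        { cover = inj₂ ∘ inj₁ ; Γ⊆Φ = λ () ; todo⊆Φ = id ; Δ⊆Φ = λ () }
    ... | inj₁ d = ∨-elim d hyp₀ (⊥-elimᶠ hyp₀)
    ... | inj₂ (M , _ , θ∈neg , model) =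
      ⊥-elim (Truth.root-unforced model θ∈neg (Cheq-valid _ (Truth.V model) root))
      where
      -- The countermodel may have dimension 0, outside the range of `Cheq`; validity descends along
      -- the projection from `𝔉 (suc n)`.
      Cheq-valid : ∀ n → 𝔉 n ⊨ θ
      Cheq-valid n = PMorphism.validity dropHead θ (θ∈Cheq (suc n) (s≤s z≤n))
        where
        dropHead : PMorphism (𝔉 (suc n)) (𝔉 n)
        dropHead = record
          { fun        = tail
          ; mono       = λ { (_ ∷ r) → r }
          ; back       = λ { {a ∷ _} r → a ∷ _ , here ∷ r , refl }
          ; surjective = λ x → w₀ ∷ x , refl
          }

-- Subformulas and the case split on variables

subformulas : Formula → List Formula
subformulas φ@(var _) = φ ∷ []
subformulas φ@⊥ᶠ      = φ ∷ []
subformulas χ@(φ ∧ ψ) = χ ∷ subformulas φ ++ subformulas ψ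
subformulas χ@(φ ∨ ψ) = χ ∷ subformulas φ ++ subformulas ψ
subformulas χ@(φ ⇒ ψ) = χ ∷ subformulas φ ++ subformulas ψ

self∈subformulas : ∀ φ → φ ∈ˡ subformulas φ
self∈subformulas (var _) = here refl
self∈subformulas ⊥ᶠ      = here refl
self∈subformulas (_ ∧ _) = here refl
self∈subformulas (_ ∨ _) = here refl
self∈subformulas (_ ⇒ _) = here refl

module _ (φ ψ : Formula) where
  private Φ′ = subformulas φ ++ subformulas ψ

  immediate⊆ : φ ∷ ψ ∷ [] ⊆ˡ Φ′
  immediate⊆ (here refl)         = ∈-++⁺ˡ (self∈subformulas φ)
  immediate⊆ (there (here refl)) = ∈-++⁺ʳ (subformulas φ) (self∈subformulas ψ)

  closed-++ : (∀ {χ} → χ ∈ˡ subformulas φ → immediate χ ⊆ˡ subformulas φ) →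
              (∀ {χ} → χ ∈ˡ subformulas ψ → immediate χ ⊆ˡ subformulas ψ) →
              ∀ {χ} → χ ∈ˡ Φ′ → immediate χ ⊆ˡ Φ′
  closed-++ cφ cψ χ∈ i with ∈-++⁻ (subformulas φ) χ∈
  ... | inj₁ χ∈φ = ∈-++⁺ˡ (cφ χ∈φ i)
  ... | inj₂ χ∈ψ = ∈-++⁺ʳ (subformulas φ) (cψ χ∈ψ i)

subformulas-closed : ∀ θ {χ} → χ ∈ˡ subformulas θ → immediate χ ⊆ˡ subformulas θ
subformulas-closed (var _) (here refl) ()
subformulas-closed ⊥ᶠ      (here refl) ()
subformulas-closed (φ ∧ ψ) (here refl) = there ∘ immediate⊆ φ ψ
subformulas-closed (φ ∨ ψ) (here refl) = there ∘ immediate⊆ φ ψ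
subformulas-closed (φ ⇒ ψ) (here refl) = there ∘ immediate⊆ φ ψ
subformulas-closed (φ ∧ ψ) (there i) =
  there ∘ closed-++ φ ψ (subformulas-closed φ) (subformulas-closed ψ) i
subformulas-closed (φ ∨ ψ) (there i) =
  there ∘ closed-++ φ ψ (subformulas-closed φ) (subformulas-closed ψ) i
subformulas-closed (φ ⇒ ψ) (there i) =
  there ∘ closed-++ φ ψ (subformulas-closed φ) (subformulas-closed ψ) i

variables : Formula → List ℕ
variables (var p) = p ∷ []
variables _       = []

var∈⇒∈variables : ∀ {p Φ} → var p ∈ˡ Φ → p ∈ˡ concatMap variables Φ
var∈⇒∈variables p∈ = ∈-concatMap⁺ variables (lose p∈ (here refl))

open NaturalDeduction {KS} ipc

Decided : List Formula → (ℕ → Bool) → ℕ → Set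
Decided H v p = H ⊢ (if v p then ¬ᶠ ¬ᶠ var p else ¬ᶠ var p)

_[_≔_] : (ℕ → Bool) → ℕ → Bool → ℕ → Bool
(v [ q ≔ b ]) p = if does (p ℕ.≟ q) then b else v p

-- Each variable is split by an instance of the weak excluded middle; `k` then argues under
-- hypotheses `H` that record one classical assignment `v`.
decide-variables : ∀ {θ} ps → (∀ H v → (∀ {p} → p ∈ˡ ps → Decided H v p) → H ⊢ θ) → [] ⊢ θ
decide-variables []       k = k [] (const false) λ ()
decide-variables (q ∷ ps) k = decide-variables ps λ H v decided →
  ∨-elim (theorem (sub (const (var q)) wem))
    (k _ (v [ q ≔ false ]) (extend decided hyp₀))
    (k _ (v [ q ≔ true ]) (extend decided hyp₀))
  where
  extend : ∀ {H v χ b} → (∀ {p} → p ∈ˡ ps → Decided H v p) →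
           χ ∷ H ⊢ (if b then ¬ᶠ ¬ᶠ var q else ¬ᶠ var q) →
           ∀ {p} → p ∈ˡ q ∷ ps → Decided (χ ∷ H) (v [ q ≔ b ]) p
  extend decided d {p} p∈ with p ℕ.≟ q | p∈
  ... | yes p≡q | _          rewrite dec-true (p ℕ.≟ q) p≡q | p≡q = d
  ... | no p≢q  | here p≡q   = contradiction p≡q p≢q
  ... | no p≢q  | there p∈ps rewrite dec-false (p ℕ.≟ q) p≢q = weaken₁ (decided p∈ps)

KS-closed : ∀ {φ} → [] ⊢ φ → KS φ
KS-closed (theorem φ∈KS) = φ∈KS
KS-closed (mp d e)       = mp (KS-closed d) (KS-closed e)

-- For each assignment, completeness is applied to the logic of formulas derivable in `KS` from `H`,
-- where the recorded choices are theorems.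
Cheq⊆KS : Cheq ⊆ KS
Cheq⊆KS {θ} θ∈Cheq = KS-closed (decide-variables (concatMap variables Φ) λ H v decided →
  relativise (Completeness.complete (λ d → theorem (ipc d)) Φ v (subformulas-closed θ)
    (λ p∈ → theorem (decided (var∈⇒∈variables p∈))) (self∈subformulas θ) θ∈Cheq))
  where
  Φ = subformulas θ

corollary5 : (Cheq ⊂ ML) × (Cheq ⊆ KS) × (¬ StructurallyComplete Cheq)
corollary5 = ((λ {φ} → Cheq⊆ML {φ}) , ML⊈Cheq) , Cheq⊆KS , Cheq-not-structurally-complete
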